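{- Let $G$ be a path-pairable graph on $n$ vertices with diameter $d \geq 20$. Then $d \leq 6\sqrt{2}\cdot\sqrt{n}$.
   Context: A graph $G$ on $n=2m$ vertices is path-pairable if for every partition of its vertex set into $m$ pairs $\{x_1,y_1\},\dots,\{x_m,y_m\}$ there exist pairwise edge-disjoint paths $P_1,\dots,P_m$ such that $P_i$ joins $x_i$ to $y_i$ for each $i$. The diameter of $G$ is the maximum distance between two vertices of $G$. -}

module Defs where

open import Data.Fin.Base using (Fin)
open import Data.List.Base using (List; []; _∷_; length)
open import Data.List.Membership.Propositional using (_∈_)
open import Data.List.Relation.Unary.Unique.Propositional using (Unique)
open import Data.Nat.Base using (ℕ; _*_; _≤_)
open import Data.Product.Base using (Σ; ∃-syntax; _×_; _,_; proj₁)
open import Data.Sum.Base using (_⊎_; [_,_])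
open import Function.Definitions using (Bijective)
open import Level using (0ℓ)
open import Relation.Binary.Construct.Closure.ReflexiveTransitive
  using (Star; ε; _◅_)
open import Relation.Binary.Core using (Rel)
open import Relation.Binary.Definitions
  using (Symmetric; Irreflexive; Decidable)
open import Relation.Binary.PropositionalEquality.Core using (_≡_; _≢_)
open import Relation.Nullary.Negation.Core using (¬_)

record Graph (n : ℕ) : Set₁ where
  field
    Adj        : Rel (Fin n) 0ℓ
    adj-sym    : Symmetric Adj
    adj-irrefl : Irreflexive _≡_ Adj
    adj?       : Decidable Adj

record Pairing (m n : ℕ) : Set where
  field
    x y       : Fin m → Fin n
    -- Every vertex is exactly one of x₁, …, xₘ, y₁, …, yₘ.
    partition : Bijective {A = Fin m ⊎ Fin m} _≡_ _≡_ [ x , y ]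

module _ {n : ℕ} (G : Graph n) where
  open Graph G

  Walk : Rel (Fin n) 0ℓ
  Walk = Star Adj

  vertices : ∀ {u v} → Walk u v → List (Fin n)
  vertices {u} ε       = u ∷ []
  vertices {u} (_ ◅ p) = u ∷ vertices p

  -- Each edge is listed in the direction in which it is traversed.
  edges : ∀ {u v} → Walk u v → List (Fin n × Fin n)
  edges ε                   = []
  edges (_◅_ {u} {w} _ p) = (u , w) ∷ edges p

  Path : Rel (Fin n) 0ℓ
  Path u v = Σ (Walk u v) λ p → Unique (vertices p)

  pathLength : ∀ {u v} → Path u v → ℕ
  pathLength p = length (edges (proj₁ p))

  _UsesEdge_─_ : ∀ {u v} → Path u v → Fin n → Fin n → Set
  p UsesEdge a ─ b = (a , b) ∈ edges (proj₁ p) ⊎ (b , a) ∈ edges (proj₁ p)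

  EdgeDisjoint : ∀ {u v u′ v′} → Path u v → Path u′ v′ → Set
  EdgeDisjoint p q = ∀ a b → ¬ (p UsesEdge a ─ b × q UsesEdge a ─ b)

  -- Without n ≡ 2 * m, every graph of odd order would be vacuously
  -- path-pairable.
  PathPairable : Set
  PathPairable = ∃[ m ] n ≡ 2 * m ×
    ((π : Pairing m n) → let open Pairing π in
      Σ (∀ i → Path (x i) (y i)) λ P →
        ∀ i j → i ≢ j → EdgeDisjoint (P i) (P j))

  IsDistance : Fin n → Fin n → ℕ → Set
  IsDistance u v k =
    (Σ (Path u v) λ p → pathLength p ≡ k) ×
    (∀ (p : Path u v) → k ≤ pathLength p)

  -- The second component also forces G to be connected: a disconnected
  -- graph has no (finite) diameter.
  IsDiameter : ℕ → Set
  IsDiameter d =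
    (∃[ u ] ∃[ v ] IsDistance u v d) ×
    (∀ u v → ∃[ k ] IsDistance u v k × k ≤ d)

{-# OPTIONS --safe #-}
-- Let f be the distance to an endpoint of a diameter, and let B i and s i be
-- the numbers of vertices with f < i and with f = i.  If B (i + 1) is at most
-- n / 2, some pairing matches {f ≤ i} into its complement; the edge-disjoint
-- paths then use B (i + 1) different edges between the layers i and i + 1,
-- so B (i + 1) ≤ s i · s (i + 1).  By AM–GM, two consecutive layers contribute
-- about 2 √B vertices, which makes B (2 j + 1) ≥ (j + 1)².  Either f or d − f
-- satisfies B h ≤ n / 2 for h = 2 ⌊d / 4⌋, and this gives d² ≤ 16 n.
module Submission where

open import Defs
open import Data.Nat
  using (ℕ; _≤_; _*_; _^_; zero; suc; _+_; _∸_; _<_; _<?_; _≤?_; _≟_; _/_; _%_;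
         s≤s; z≤n; s≤s⁻¹)
open import Data.Nat.Properties
open import Data.Nat.DivMod using (m≡m%n+[m/n]*n; m%n<n; m/n*n≤m)
open import Data.Nat.Tactic.RingSolver using (solve-∀)
open import Data.Fin using (Fin; zero; suc; toℕ; cast; inject≤; combine; join; splitAt; _↑ˡ_; _↑ʳ_)
import Data.Fin.Properties as Fin
open import Data.List using (List; []; _∷_; _++_; length; lookup; filter; allFin)
open import Data.List.Properties using (length-filter; length-tabulate)
open import Data.List.Membership.Propositional using (_∈_)
import Data.List.Membership.DecPropositional as DecMembership
open import Data.List.Membership.Propositional.Properties
  using (∈-allFin; ∈-filter⁺; ∈-filter⁻; ∈-lookup; ∈-++⁺ˡ; ∈-++⁺ʳ)
open import Data.List.Membership.Setoid.Properties using (index-injective)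
open import Data.List.Relation.Unary.All as All using (All; []; _∷_)
open import Data.List.Relation.Unary.All.Properties using (all-filter; ¬Any⇒All¬)
open import Data.List.Relation.Unary.AllPairs using ([]; _∷_)
open import Data.List.Relation.Unary.Any using (here; there; index)
open import Data.List.Relation.Unary.Any.Properties using (lookup-index)
open import Data.List.Relation.Unary.Unique.Propositional using (Unique)
import Data.List.Relation.Unary.Unique.Propositional.Properties as Unique
open import Data.Product using (Σ; ∃-syntax; _×_; _,_; proj₁; proj₂)
open import Data.Sum using (_⊎_; inj₁; inj₂; [_,_])
open import Data.Unit using (tt)
open import Function using (_∘_)
open import Level using (Level; 0ℓ)
open import Relation.Binary.Construct.Closure.ReflexiveTransitive using (ε; _◅_)
open import Relation.Binary.PropositionalEquality
  using (_≡_; _≢_; refl; sym; trans; cong; subst; subst₂; setoid)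
open import Relation.Nullary using (¬_; yes; no; contradiction)
open import Relation.Nullary.Decidable using (decidable-stable)
open import Relation.Unary using (Pred; Decidable)
open import Relation.Unary.Properties using (∁?; U?)

private variable
  a : Level
  A : Set a

-- Arithmetic

4ab≤[a+b]² : ∀ a b → 4 * (a * b) ≤ (a + b) * (a + b)
4ab≤[a+b]² a b with ≤-total a b
... | inj₁ a≤b with k , refl ← m≤n⇒∃[o]m+o≡n a≤b =
  subst (4 * (a * (a + k)) ≤_) (lem a k) (m≤m+n _ (k * k))
  where
  lem : ∀ a k → 4 * (a * (a + k)) + k * k ≡ (a + (a + k)) * (a + (a + k))
  lem = solve-∀
... | inj₂ b≤a with k , refl ← m≤n⇒∃[o]m+o≡n b≤a =
  subst (4 * ((b + k) * b) ≤_) (lem b k) (m≤m+n _ (k * k))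
  where
  lem : ∀ b k → 4 * ((b + k) * b) + k * k ≡ (b + k + b) * (b + k + b)
  lem = solve-∀

-- If `a + b ≤ 2 * p`, then AM-GM would give `a * b ≤ p * p`. The strict form matters: it supplies
-- the final 1 in `(p + 1)² = p² + 2 p + 1`.
p²<ab⇒2p<a+b : ∀ p a b → p * p < a * b → 2 * p < a + b
p²<ab⇒2p<a+b p a b p²<ab = ≰⇒> λ a+b≤2p → <⇒≱ p²<ab (*-cancelˡ-≤ 4 (begin
  4 * (a * b)        ≤⟨ 4ab≤[a+b]² a b ⟩
  (a + b) * (a + b)  ≤⟨ *-mono-≤ a+b≤2p a+b≤2p ⟩
  2 * p * (2 * p)    ≡⟨ lem p ⟩
  4 * (p * p)        ∎))
  where
  open ≤-Reasoning
  lem : ∀ p → 2 * p * (2 * p) ≡ 4 * (p * p)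
  lem = solve-∀

-- The inductive step for balls: `w` is the size of a ball, `a` and `b` are those of the next two
-- layers, and `w + a ≤ a * b` comes from the cut. It forces `a > 0`, hence `w < a * b`, so AM-GM
-- applies in its strict form.
square-growth : ∀ p w a b → suc p * suc p ≤ w → w + a ≤ a * b →
                suc (suc p) * suc (suc p) ≤ w + a + b
square-growth p w zero b p²≤w w≤0 =
  contradiction (≤-trans p²≤w (≤-trans (m≤m+n w 0) w≤0)) λ ()
square-growth p w a@(suc _) b p²≤w w+a≤ab = begin
  suc (suc p) * suc (suc p)          ≡⟨ lem p ⟩
  suc p * suc p + suc (2 * suc p)    ≤⟨ +-mono-≤ p²≤w (p²<ab⇒2p<a+b (suc p) a b p²<ab) ⟩
  w + (a + b)                        ≡⟨ +-assoc w a b ⟨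
  w + a + b                          ∎
  where
  open ≤-Reasoning
  lem : ∀ p → suc (suc p) * suc (suc p) ≡ suc p * suc p + suc (2 * suc p)
  lem = solve-∀
  p²<ab : suc p * suc p < a * b
  p²<ab = ≤-trans (≤-<-trans p²≤w (m<m+n w (s≤s z≤n))) w+a≤ab

d≤4[1+d/4] : ∀ d → d ≤ 4 * suc (d / 4)
d≤4[1+d/4] d = begin
  d                      ≡⟨ m≡m%n+[m/n]*n d 4 ⟩
  d % 4 + d / 4 * 4      ≤⟨ +-monoˡ-≤ _ (<⇒≤ (m%n<n d 4)) ⟩
  4 + d / 4 * 4          ≡⟨ *-comm (suc (d / 4)) 4 ⟩
  4 * suc (d / 4)        ∎
  where open ≤-Reasoning

m+n≤2o⇒m≤o⊎n≤o : ∀ m n o → m + n ≤ 2 * o → m ≤ o ⊎ n ≤ o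
m+n≤2o⇒m≤o⊎n≤o m n o m+n≤2o with m ≤? o
... | yes m≤o = inj₁ m≤o
... | no  m≰o = inj₂ (+-cancelˡ-≤ o n o (begin
  o + n        ≤⟨ +-monoˡ-≤ n (<⇒≤ (≰⇒> m≰o)) ⟩
  m + n        ≤⟨ m+n≤2o ⟩
  o + (o + 0)  ≡⟨ cong (o +_) (+-identityʳ o) ⟩
  o + o        ∎))
  where open ≤-Reasoning

-- Lists

-- The common counting step: a ball and its next layer, monotonicity of balls, and the two balls
-- around opposite ends are all instances.
length-filter-⊎ : ∀ {P Q R : Pred A 0ℓ} (P? : Decidable P) (Q? : Decidable Q) (R? : Decidable R) →
                  (∀ {x} → P x → ¬ Q x) → (∀ {x} → P x → R x) → (∀ {x} → Q x → R x) →
                  ∀ xs → length (filter P? xs) + length (filter Q? xs) ≤ length (filter R? xs)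
length-filter-⊎ P? Q? R? P#Q P⇒R Q⇒R [] = z≤n
length-filter-⊎ P? Q? R? P#Q P⇒R Q⇒R (x ∷ xs)
  with ih ← length-filter-⊎ P? Q? R? P#Q P⇒R Q⇒R xs
  with P? x | Q? x | R? x
... | yes p | yes q | _     = contradiction q (P#Q p)
... | yes p | no _  | yes _ = s≤s ih
... | yes p | no _  | no ¬r = contradiction (P⇒R p) ¬r
... | no _  | yes q | yes _ =
  ≤-trans (≤-reflexive (+-suc (length (filter P? xs)) (length (filter Q? xs)))) (s≤s ih)
... | no _  | yes q | no ¬r = contradiction (Q⇒R q) ¬r
... | no _  | no _  | yes _ = m≤n⇒m≤1+n ih
... | no _  | no _  | no _  = ih

lookup-injective : ∀ {xs : List A} → Unique xs → ∀ {i j} → lookup xs i ≡ lookup xs j → i ≡ j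
lookup-injective (_ ∷ _)   {zero}  {zero}  _  = refl
lookup-injective (x∉ ∷ _)  {zero}  {suc j} eq = contradiction eq (All.lookup x∉ (∈-lookup j))
lookup-injective (x∉ ∷ _)  {suc i} {zero}  eq = contradiction (sym eq) (All.lookup x∉ (∈-lookup i))
lookup-injective (_ ∷ xs!) {suc i} {suc j} eq = cong suc (lookup-injective xs! eq)

lookup-++-< : ∀ {P : Pred A 0ℓ} {xs} ys → All P xs →
              ∀ i → toℕ i < length xs → P (lookup (xs ++ ys) i)
lookup-++-< ys (px ∷ _)   zero    _         = px
lookup-++-< ys (_  ∷ pxs) (suc i) (s≤s i<n) = lookup-++-< ys pxs i i<n

lookup-++-≥ : ∀ {P : Pred A 0ℓ} xs {ys} → All P ys →
              ∀ i → length xs ≤ toℕ i → P (lookup (xs ++ ys) i)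
lookup-++-≥ []       pys i       _         = All.lookup pys (∈-lookup i)
lookup-++-≥ (_ ∷ xs) pys (suc i) (s≤s n≤i) = lookup-++-≥ xs pys i n≤i

-- Pairings obtained from enumerations of the vertices

module _ {n : ℕ} {xs : List (Fin n)} (xs! : Unique xs) (complete : ∀ v → v ∈ xs) where

  length-enumeration : length xs ≡ n
  length-enumeration = ≤-antisym
    (Fin.injective⇒≤ (lookup-injective xs!))
    (Fin.injective⇒≤ λ {u} {v} → index-injective (setoid (Fin n)) (complete u) (complete v))

  module _ {m : ℕ} (n≡2m : n ≡ 2 * m) where

    private
      m+m≡length : m + m ≡ length xs
      m+m≡length = trans (cong (m +_) (sym (+-identityʳ m))) (trans (sym n≡2m) (sym length-enumeration))

    position : Fin m ⊎ Fin m → Fin (length xs)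
    position = cast m+m≡length ∘ join m m

    toℕ-position₁ : ∀ j → toℕ (position (inj₁ j)) ≡ toℕ j
    toℕ-position₁ j = trans (Fin.toℕ-cast _ (j ↑ˡ m)) (Fin.toℕ-↑ˡ j m)

    toℕ-position₂ : ∀ j → toℕ (position (inj₂ j)) ≡ m + toℕ j
    toℕ-position₂ j = trans (Fin.toℕ-cast _ (m ↑ʳ j)) (Fin.toℕ-↑ʳ m j)

    position-injective : ∀ {i j} → position i ≡ position j → i ≡ j
    position-injective {i} {j} eq = trans (sym (Fin.splitAt-join m m i)) (trans
      (cong (splitAt m) (Fin.toℕ-injective (trans (sym (Fin.toℕ-cast _ (join m m i)))
        (trans (cong toℕ eq) (Fin.toℕ-cast _ (join m m j))))))
      (Fin.splitAt-join m m j))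

    position-surjective : ∀ k → ∃[ i ] position i ≡ k
    position-surjective k = splitAt m k′ ,
      trans (cong (cast m+m≡length) (Fin.join-splitAt m m k′))
            (Fin.cast-involutive m+m≡length (sym m+m≡length) k)
      where k′ = cast (sym m+m≡length) k

    -- Entry `j` of the enumeration is paired with entry `m + j`, so the order of the list decides
    -- which vertices become an `x` and which a `y`.
    halves : Pairing m n
    halves = record
      { x = lookup xs ∘ position ∘ inj₁
      ; y = lookup xs ∘ position ∘ inj₂
      ; partition = (λ {i} {j} eq → position-injective (lookup-injective xs!
                      (trans (sym (lookup-position i)) (trans eq (lookup-position j)))))
                  , λ v → let i , eq = position-surjective (index (complete v)) in
                      i , λ { refl → trans (lookup-position i)
                                      (trans (cong (lookup xs) eq) (sym (lookup-index (complete v)))) }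
      }
      where
      lookup-position : ∀ i → [ lookup xs ∘ position ∘ inj₁ , lookup xs ∘ position ∘ inj₂ ] i
                              ≡ lookup xs (position i)
      lookup-position (inj₁ _) = refl
      lookup-position (inj₂ _) = refl

module _ {n m : ℕ} (n≡2m : n ≡ 2 * m) {P : Pred (Fin n) 0ℓ} (P? : Decidable P) where

  private
    inside outside : List (Fin n)
    inside  = filter P? (allFin n)
    outside = filter (∁? P?) (allFin n)

  -- Listing the vertices of `P` first places all of them in the first half, since there are at most
  -- `m`; every entry of the second half then lies outside `P`.
  crossing-pairing : length inside ≤ m →
    ∃[ π ] let open Pairing {m} {n} π in (∀ j → toℕ j < length inside → P (x j)) × (∀ j → ¬ P (y j))
  crossing-pairing k≤m = halves xs! complete n≡2m
    , (λ j j<k → lookup-++-< outside (all-filter P? (allFin n)) _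
        (subst (_< length inside) (sym (toℕ-position₁ xs! complete n≡2m j)) j<k))
    , (λ j → lookup-++-≥ inside (all-filter (∁? P?) (allFin n)) _
        (subst (length inside ≤_) (sym (toℕ-position₂ xs! complete n≡2m j))
          (≤-trans k≤m (m≤m+n m (toℕ j)))))
    where
    xs! : Unique (inside ++ outside)
    xs! = Unique.++⁺ (Unique.filter⁺ P? (Unique.allFin⁺ n)) (Unique.filter⁺ (∁? P?) (Unique.allFin⁺ n))
      λ (v∈i , v∈o) → proj₂ (∈-filter⁻ (∁? P?) {xs = allFin n} v∈o)
                            (proj₂ (∈-filter⁻ P? {xs = allFin n} v∈i))
    complete : ∀ v → v ∈ inside ++ outside
    complete v with P? v
    ... | yes p = ∈-++⁺ˡ (∈-filter⁺ P? (∈-allFin v) p)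
    ... | no ¬p = ∈-++⁺ʳ inside (∈-filter⁺ (∁? P?) (∈-allFin v) ¬p)

-- Distance layers and cuts

module _ {n : ℕ} (G : Graph n) where
  open Graph G
  open DecMembership (Fin._≟_ {n}) using (_∈?_)

  suffix : ∀ {u v w} (p : Path G u v) → w ∈ vertices G (proj₁ p) →
           ∃[ q ] pathLength G {w} {v} q ≤ pathLength G p
  suffix p@(ε , _)             (here refl) = p , ≤-refl
  suffix p@(_ ◅ _ , _)         (here refl) = p , ≤-refl
  suffix (_ ◅ p , _ ∷ p!)      (there w∈p) = let q , q≤p = suffix (p , p!) w∈p in q , m≤n⇒m≤1+n q≤p

  -- Paths may not repeat a vertex. If `u` already lies on the path, the part of it starting at `u`
  -- serves instead and is no longer.
  prepend : ∀ {u v w} → Adj u w → (p : Path G w v) →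
            ∃[ q ] pathLength G {u} {v} q ≤ suc (pathLength G p)
  prepend {u} e (p , p!) with u ∈? vertices G p
  ... | yes u∈p = let q , q≤p = suffix (p , p!) u∈p in q , m≤n⇒m≤1+n q≤p
  ... | no  u∉p = (e ◅ p , ¬Any⇒All¬ _ u∉p ∷ p!) , ≤-refl

  -- The only property of a distance that the cut argument uses besides a zero. It lets one argument
  -- treat both `f` and `d ∸ f`, that is, both ends of the diameter. Symmetry of `Adj` gives the
  -- reverse inequality.
  Lipschitz : (Fin n → ℕ) → Set
  Lipschitz f = ∀ {a b} → Adj a b → f a ≤ suc (f b)

  distance-lipschitz : ∀ {f v} → (∀ a → IsDistance G a v (f a)) → Lipschitz f
  distance-lipschitz dist {a} {b} e with (p , |p|≡fb) , _ ← dist b =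
    let q , q≤ = prepend e p in
    ≤-trans (proj₂ (dist a) q) (≤-trans q≤ (s≤s (≤-reflexive |p|≡fb)))

  ∸-lipschitz : ∀ {f} d → Lipschitz f → Lipschitz (λ a → d ∸ f a)
  ∸-lipschitz {f} d lip {a} {b} e = begin
    d ∸ f a              ≤⟨ m≤n+m∸n (d ∸ f a) 1 ⟩
    suc (d ∸ f a ∸ 1)    ≡⟨ cong suc (∸-+-assoc d (f a) 1) ⟩
    suc (d ∸ (f a + 1))  ≡⟨ cong (λ k → suc (d ∸ k)) (+-comm (f a) 1) ⟩
    suc (d ∸ suc (f a))  ≤⟨ s≤s (∸-monoʳ-≤ d (lip (adj-sym e))) ⟩
    suc (d ∸ f b)        ∎
    where open ≤-Reasoning

  module _ (f : Fin n → ℕ) where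

    ball layer : ℕ → List (Fin n)
    ball  i = filter (λ a → f a <? i) (allFin n)
    layer i = filter (λ a → f a ≟ i) (allFin n)

    ball+layer : ∀ i → length (ball i) + length (layer i) ≤ length (ball (suc i))
    ball+layer i = length-filter-⊎ (λ a → f a <? i) (λ a → f a ≟ i) (λ a → f a <? suc i)
      <⇒≢ m<n⇒m<1+n (λ eq → s≤s (≤-reflexive eq)) (allFin n)

    ball-mono : ∀ {i j} → i ≤ j → length (ball i) ≤ length (ball j)
    ball-mono {i} {j} i≤j = ≤-trans (m≤m+n _ _)
      -- The second class, `∁? U?`, is empty.
      (length-filter-⊎ (λ a → f a <? i) (∁? U?) (λ a → f a <? j)
        (λ _ ¬u → ¬u tt) (λ lt → <-≤-trans lt i≤j) (λ ¬u → contradiction tt ¬u) (allFin n))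

  -- The first edge leaving `{f ≤ i}` works: `f` rises by at most one along an edge, so it cannot
  -- skip a layer.
  crossing-edge : ∀ {f} → Lipschitz f → ∀ i {u v} (p : Walk G u v) → f u ≤ i → i < f v →
                  ∃[ a ] ∃[ b ] (a , b) ∈ edges G p × f a ≡ i × f b ≡ suc i
  crossing-edge lip i ε fu≤i i<fu = contradiction fu≤i (<⇒≱ i<fu)
  crossing-edge {f} lip i {u} (_◅_ {j = w} e p) fu≤i i<fv with f w ≤? i
  ... | yes fw≤i = let a , b , ab∈p , eqs = crossing-edge lip i p fw≤i i<fv in a , b , there ab∈p , eqs
  ... | no  fw≰i = u , w , here refl
    , ≤-antisym fu≤i (s≤s⁻¹ (≤-trans (≰⇒> fw≰i) lip′))
    , ≤-antisym (≤-trans lip′ (s≤s fu≤i)) (≰⇒> fw≰i)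
    where lip′ = lip (adj-sym e)

  -- Cuts and ball growth in a path-pairable graph

  Linked : ∀ {m} → Pairing m n → Set
  Linked π = Σ (∀ i → Path G (x i) (y i)) λ P → ∀ i j → i ≢ j → EdgeDisjoint G (P i) (P j)
    where open Pairing π

  module _ {m : ℕ} (n≡2m : n ≡ 2 * m)
    (pairable : (π : Pairing m n) → Linked π)
    {f : Fin n → ℕ} (lip : Lipschitz f) where

    -- Each of the first `length (ball f (suc i))` pairs has its path cross from layer `i` to layer
    -- `suc i`. Coding a crossing edge by the positions of its ends in these layers is injective,
    -- because the paths share no edge.
    cut-bound : ∀ i → length (ball f (suc i)) ≤ m →
                length (ball f (suc i)) ≤ length (layer f i) * length (layer f (suc i))
    cut-bound i k≤m = Fin.injective⇒≤ code-injective
      where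
      pairing  = crossing-pairing n≡2m (λ a → f a <? suc i) k≤m
      π        = proj₁ pairing
      open Pairing π
      P        = proj₁ (pairable π)
      disjoint = proj₂ (pairable π)

      pair : Fin (length (ball f (suc i))) → Fin m
      pair k = inject≤ k k≤m

      crossing : ∀ k → ∃[ a ] ∃[ b ] (a , b) ∈ edges G (proj₁ (P (pair k))) × f a ≡ i × f b ≡ suc i
      crossing k = crossing-edge lip i (proj₁ (P (pair k)))
        (s≤s⁻¹ (proj₁ (proj₂ pairing) (pair k)
          (subst (_< length (ball f (suc i))) (sym (Fin.toℕ-inject≤ k k≤m)) (Fin.toℕ<n k))))
        (s≤s⁻¹ (≰⇒> (proj₂ (proj₂ pairing) (pair k))))

      source target : Fin (length (ball f (suc i))) → Fin n
      source k = proj₁ (crossing k)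
      target k = proj₁ (proj₂ (crossing k))

      edge∈ : ∀ k → (source k , target k) ∈ edges G (proj₁ (P (pair k)))
      edge∈ k = proj₁ (proj₂ (proj₂ (crossing k)))

      source∈ : ∀ k → source k ∈ layer f i
      source∈ k = ∈-filter⁺ (λ a → f a ≟ i) (∈-allFin _) (proj₁ (proj₂ (proj₂ (proj₂ (crossing k)))))

      target∈ : ∀ k → target k ∈ layer f (suc i)
      target∈ k = ∈-filter⁺ (λ a → f a ≟ suc i) (∈-allFin _) (proj₂ (proj₂ (proj₂ (proj₂ (crossing k)))))

      code : Fin (length (ball f (suc i))) → Fin (length (layer f i) * length (layer f (suc i)))
      code k = combine (index (source∈ k)) (index (target∈ k))

      code-injective : ∀ {k l} → code k ≡ code l → k ≡ l
      code-injective {k} {l} eq = Fin.inject≤-injective k≤m k≤m k l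
        (decidable-stable (pair k Fin.≟ pair l) λ k≢l →
          disjoint (pair k) (pair l) k≢l (source k) (target k)
            ( inj₁ (edge∈ k)
            , inj₁ (subst₂ (λ a b → (a , b) ∈ edges G (proj₁ (P (pair l))))
                     (sym source≡) (sym target≡) (edge∈ l))))
        where
        indices≡ = Fin.combine-injective (index (source∈ k)) (index (target∈ k))
                                         (index (source∈ l)) (index (target∈ l)) eq
        source≡ : source k ≡ source l
        source≡ = index-injective (setoid (Fin n)) (source∈ k) (source∈ l) (proj₁ indices≡)
        target≡ : target k ≡ target l
        target≡ = index-injective (setoid (Fin n)) (target∈ k) (target∈ l) (proj₂ indices≡)

    -- The induction advances by two layers, as AM-GM bounds the sum of two consecutive layers and
    -- neither one alone.
    ball-growth : ∀ {v} → f v ≡ 0 → ∀ j → length (ball f (2 * j)) ≤ m →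
                  suc j * suc j ≤ length (ball f (suc (2 * j)))
    ball-growth {v} fv≡0 zero _ =
      0<length (∈-filter⁺ (λ a → f a <? 1) (∈-allFin v) (s≤s (≤-reflexive fv≡0)))
      where
      0<length : ∀ {xs} → v ∈ xs → 1 ≤ length xs
      0<length (here _)  = s≤s z≤n
      0<length (there _) = s≤s z≤n
    ball-growth fv≡0 (suc j) small = subst
      (λ k → suc (suc j) * suc (suc j) ≤ length (ball f (suc k))) (sym 2+2j) (≤-trans
      (square-growth j _ (s (suc (2 * j))) (s (2 + 2 * j))
        (ball-growth fv≡0 j (≤-trans (ball-mono f (*-monoʳ-≤ 2 (n≤1+n j))) small))
        -- The ball of radius `2 + 2 * j` contains the previous ball and layer, and its outgoing cut
        -- is bounded by the product of the two layers.
        (≤-trans (ball+layer f (suc (2 * j)))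
          (cut-bound (suc (2 * j)) (subst (λ k → length (ball f k) ≤ m) 2+2j small))))
      (≤-trans (+-monoˡ-≤ _ (ball+layer f (suc (2 * j)))) (ball+layer f (2 + 2 * j))))
      where
      s : ℕ → ℕ
      s i = length (layer f i)
      2+2j : 2 * suc j ≡ 2 + 2 * j
      2+2j = *-suc 2 j

    square≤order : ∀ {v} → f v ≡ 0 → ∀ j → length (ball f (2 * j)) ≤ m → suc j * suc j ≤ n
    square≤order fv≡0 j small = begin
      suc j * suc j                  ≤⟨ ball-growth fv≡0 j small ⟩
      length (ball f (suc (2 * j)))  ≤⟨ length-filter _ (allFin n) ⟩
      length (allFin n)              ≡⟨ length-tabulate _ ⟩
      n                              ∎
      where open ≤-Reasoning

  -- The balls are disjoint: a common vertex would give `d ≤ f a + (d ∸ f a) < h + h`.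
  ball+coball : ∀ f {d h} → h + h ≤ d → length (ball f h) + length (ball (λ a → d ∸ f a) h) ≤ n
  ball+coball f {d} {h} h+h≤d = begin
    length (ball f h) + length (ball (λ a → d ∸ f a) h)
      ≤⟨ length-filter-⊎ (λ a → f a <? h) (λ a → d ∸ f a <? h) U?
           (λ {a} fa<h d∸fa<h → <⇒≱ (+-mono-< fa<h d∸fa<h) (≤-trans h+h≤d (m≤n+m∸n d (f a))))
           (λ _ → tt) (λ _ → tt) (allFin n) ⟩
    length (filter U? (allFin n))
      ≤⟨ length-filter U? (allFin n) ⟩
    length (allFin n)
      ≡⟨ length-tabulate _ ⟩
    n ∎
    where open ≤-Reasoning

-- The bound on the diameter

theorem1 : ∀ (n d : ℕ) (G : Graph n) → PathPairable G → IsDiameter G d → 20 ≤ d → d ^ 2 ≤ (6 ^ 2 * 2) * n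
theorem1 n d G (m , n≡2m , pairable) ((u , v , (p , |p|≡d) , d≤) , distances) _ = begin
  d ^ 2                              ≡⟨ cong (d *_) (*-identityʳ d) ⟩
  d * d                              ≤⟨ *-mono-≤ (d≤4[1+d/4] d) (d≤4[1+d/4] d) ⟩
  4 * suc j * (4 * suc j)            ≡⟨ [m*n]*[o*p]≡[m*o]*[n*p] 4 (suc j) 4 (suc j) ⟩
  -- The argument yields the constant 16; the slack up to 72 is 56.
  16 * (suc j * suc j)               ≤⟨ *-mono-≤ (m≤m+n 16 56) [1+j]²≤n ⟩
  (6 ^ 2 * 2) * n                    ∎
  where
  open ≤-Reasoning
  j = d / 4

  f : Fin n → ℕ
  f a = proj₁ (distances a v)

  f-distance : ∀ a → IsDistance G a v (f a)
  f-distance a = proj₁ (proj₂ (distances a v))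

  f-lipschitz : Lipschitz G f
  f-lipschitz = distance-lipschitz G f-distance

  fv≡0 : f v ≡ 0
  fv≡0 = n≤0⇒n≡0 (proj₂ (f-distance v) (ε , [] ∷ []))

  d≤fu : d ≤ f u
  -- This makes `d ∸ f u` zero, so `u` can be the centre of the second family of balls.
  d≤fu with (q , eq) , _ ← f-distance u = subst (d ≤_) eq (d≤ q)

  2j+2j≤d : 2 * j + 2 * j ≤ d
  2j+2j≤d = ≤-trans (≤-reflexive (lem j)) (m/n*n≤m d 4)
    where
    lem : ∀ j → 2 * j + 2 * j ≡ j * 4
    lem = solve-∀

  [1+j]²≤n : suc j * suc j ≤ n
  -- The two balls have at most `n ≡ 2 * m` vertices together, so one of them has at most `m`, and
  -- growth is run from its centre, `v` or `u`.
  [1+j]²≤n with m+n≤2o⇒m≤o⊎n≤o _ _ m (≤-trans (ball+coball G f 2j+2j≤d) (≤-reflexive n≡2m))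
  ... | inj₁ small = square≤order G n≡2m pairable f-lipschitz fv≡0 j small
  ... | inj₂ small = square≤order G n≡2m pairable (∸-lipschitz G d f-lipschitz) (m≤n⇒m∸n≡0 d≤fu) j small
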